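{- Let $\Phi$ be an epimorphism of a finite thick projective plane $\mathcal{P}$ onto a thin projective plane $\Delta$ of order $(1,1)$ (an ordinary triangle). Then exactly two classes of epimorphisms $\Phi$ occur, up to a suitable permutation of the points of $\Delta$; that is, after suitably naming the points of $\Delta$, $\Phi$ is as in (a) or (b) below, and both classes occur. (a) The points of $\Delta$ are $\overline{a},\overline{b},\overline{c}$ (pairwise collinear); put $\widetilde{A}=\Phi^{ -1}(\overline{a})$, $\widetilde{B}=\Phi^{ -1}(\overline{b})$, $\widetilde{C}=\Phi^{ -1}(\overline{c})$. There is a line $L$ of $\mathcal{P}$ such that $(\widetilde{A},\widetilde{B})$, with $\widetilde{A}\neq\emptyset\neq\widetilde{B}$, is a partition of the set of all points incident with $L$, and $\widetilde{C}$ consists of the points not incident with $L$. Furthermore, $\Phi^{ -1}(\overline{a}\overline{b})=\{L\}$, $\Phi^{ -1}(\overline{b}\overline{c})$ is the set of all lines distinct from $L$ but incident with a point of $\widetilde{B}$, and $\Phi^{ -1}(\overline{a}\overline{c})$ is the set of all lines distinct from $L$ but incident with a point of $\widetilde{A}$. (b) The dual of (a), i.e. $\Phi$, regarded as an epimorphism from the point-line dual of $\mathcal{P}$ onto the point-line dual of $\Delta$, is as in (a).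
   Context: A thick projective plane is a generalized $3$-gon, i.e. an axiomatic projective plane in which every line has at least three points and every point is on at least three lines. The thin projective plane $\Delta$ of order $(1,1)$ is the ordinary triangle: three points, three lines, every line incident with exactly two points and every point with exactly two lines. A morphism between point-line geometries maps points to points, lines to lines, and preserves incidence. An epimorphism is a morphism that is surjective on points and surjective on lines (surjectivity on incident point-line pairs is not required). $\overline{x}\overline{y}$ denotes the line joining the distinct collinear points $\overline{x},\overline{y}$. The point-line dual of a geometry is obtained by interchanging the roles of points and lines. -}

module Defs where

open import Data.Fin.Base using (Fin)
open import Data.Nat.Base using (ℕ)
open import Data.Product using (∃; ∃!; ∃-syntax; _×_; _,_; proj₁)
open import Function.Bundles using (_↔_)
open import Function.Definitions using (StrictlySurjective)
open import Level using (0ℓ)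
open import Relation.Binary.PropositionalEquality
  using (_≡_; _≢_; refl; sym; trans)
open import Relation.Nullary.Negation using (¬_)
open import Relation.Unary
  using (Pred; _∈_; _≐_; _⊥_; _∪_; ∁; ｛_｝; _⊢_; Satisfiable)

AtLeastThree : {X : Set} → Pred X 0ℓ → Set
AtLeastThree S =
  ∃[ x ] ∃[ y ] ∃[ z ] x ≢ y × y ≢ z × x ≢ z × x ∈ S × y ∈ S × z ∈ S

ExactlyTwo : {X : Set} → Pred X 0ℓ → Set
ExactlyTwo S = ∃[ x ] ∃[ y ] x ≢ y × S ≐ (｛ x ｝ ∪ ｛ y ｝)

HasSize : Set → ℕ → Set
HasSize X n = X ↔ Fin n

Finite : Set → Set
Finite X = ∃ (HasSize X)

-- S is partitioned into the two nonempty sets A and B.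
Partition : {X : Set} → (S A B : Pred X 0ℓ) → Set
Partition S A B = S ≐ (A ∪ B) × A ⊥ B × Satisfiable A × Satisfiable B

record Geometry : Set₁ where
  infix 4 _I_
  field
    Point : Set
    Line  : Set
    _I_   : Point → Line → Set

  pointsOn : Line → Pred Point 0ℓ
  pointsOn L x = x I L

  linesThrough : Point → Pred Line 0ℓ
  linesThrough x L = x I L

dual : Geometry → Geometry
dual 𝒢 = record
  { Point = Geometry.Line 𝒢
  ; Line  = Geometry.Point 𝒢
  ; _I_   = λ L x → Geometry._I_ 𝒢 x L
  }

-- Nondegeneracy asks for a triangle rather than for a quadrangle, so that the
-- ordinary triangle is an instance.  When every line has at least three points
-- and every point is on at least three lines, a quadrangle exists as well.
record IsProjectivePlane (𝒢 : Geometry) : Set where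
  open Geometry 𝒢
  field
    uniqueJoin : ∀ {x y} → x ≢ y → ∃! _≡_ λ L → x I L × y I L
    uniqueMeet : ∀ {L M} → L ≢ M → ∃! _≡_ λ x → x I L × x I M
    triangle   : ∃[ x ] ∃[ y ] ∃[ z ] x ≢ y × y ≢ z × x ≢ z ×
                 (∀ L → ¬ (x I L × y I L × z I L))

  join : ∀ {x y} → x ≢ y → Line
  join x≢y = proj₁ (uniqueJoin x≢y)

record FiniteThickPlane : Set₁ where
  field
    geometry          : Geometry
    isProjectivePlane : IsProjectivePlane geometry
  open Geometry geometry public
  open IsProjectivePlane isProjectivePlane public
  field
    finitePoints : Finite Point
    finiteLines  : Finite Line
    thickLines   : ∀ L → AtLeastThree (pointsOn L)
    thickPoints  : ∀ x → AtLeastThree (linesThrough x)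

-- The thin projective plane of order (1,1).
record OrdinaryTriangle : Set₁ where
  field
    geometry          : Geometry
    isProjectivePlane : IsProjectivePlane geometry
  open Geometry geometry public
  open IsProjectivePlane isProjectivePlane public
  field
    threePoints : HasSize Point 3
    threeLines  : HasSize Line 3
    thinLines   : ∀ L → ExactlyTwo (pointsOn L)
    thinPoints  : ∀ x → ExactlyTwo (linesThrough x)

record Epimorphism (𝒢 ℋ : Geometry) : Set where
  private
    module 𝒢 = Geometry 𝒢
    module ℋ = Geometry ℋ
  field
    onPoints           : 𝒢.Point → ℋ.Point
    onLines            : 𝒢.Line → ℋ.Line
    preservesIncidence : ∀ {x L} → x 𝒢.I L → onPoints x ℋ.I onLines L
    surjectiveOnPoints : StrictlySurjective _≡_ onPoints
    surjectiveOnLines  : StrictlySurjective _≡_ onLines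

dualIsProjectivePlane : ∀ {𝒢} → IsProjectivePlane 𝒢 → IsProjectivePlane (dual 𝒢)
dualIsProjectivePlane {𝒢} pl = record
  { uniqueJoin = uniqueMeet
  ; uniqueMeet = uniqueJoin
  ; triangle   = dualTriangle triangle
  }
  where
  open Geometry 𝒢
  open IsProjectivePlane pl

  dualTriangle :
    (∃[ x ] ∃[ y ] ∃[ z ] x ≢ y × y ≢ z × x ≢ z ×
      (∀ L → ¬ (x I L × y I L × z I L))) →
    ∃[ L ] ∃[ M ] ∃[ N ] L ≢ M × M ≢ N × L ≢ N ×
      (∀ p → ¬ (p I L × p I M × p I N))
  dualTriangle (x , y , z , x≢y , y≢z , x≢z , nc)
    with uniqueJoin x≢y | uniqueJoin y≢z | uniqueJoin x≢z
  ... | L , (xL , yL) , _ | M , (yM , zM) , _ | N , (xN , zN) , _ =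
    L , M , N , L≢M , M≢N , L≢N , λ where
      p (pL , pM , pN) → x≢y (trans
        (meetUnique L≢N (xL , xN) (pL , pN))
        (meetUnique L≢M (pL , pM) (yL , yM)))
    where
    L≢M : L ≢ M
    L≢M refl = nc L (xL , yL , zM)
    M≢N : M ≢ N
    M≢N refl = nc M (xN , yM , zM)
    L≢N : L ≢ N
    L≢N refl = nc L (xL , yL , zN)

    meetUnique : ∀ {K K′ p q} → K ≢ K′ → p I K × p I K′ → q I K × q I K′ → p ≡ q
    meetUnique K≢K′ p∈ q∈ with uniqueMeet K≢K′
    ... | _ , _ , unique = trans (sym (unique p∈)) (unique q∈)

dualPlane : FiniteThickPlane → FiniteThickPlane
dualPlane 𝒫 = record
  { geometry          = dual geometry
  ; isProjectivePlane = dualIsProjectivePlane isProjectivePlane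
  ; finitePoints      = finiteLines
  ; finiteLines       = finitePoints
  ; thickLines        = thickPoints
  ; thickPoints       = thickLines
  }
  where open FiniteThickPlane 𝒫

dualOrdinaryTriangle : OrdinaryTriangle → OrdinaryTriangle
dualOrdinaryTriangle Δ = record
  { geometry          = dual geometry
  ; isProjectivePlane = dualIsProjectivePlane isProjectivePlane
  ; threePoints       = threeLines
  ; threeLines        = threePoints
  ; thinLines         = thinPoints
  ; thinPoints        = thinLines
  }
  where open OrdinaryTriangle Δ

dualEpimorphism : ∀ {𝒢 ℋ} → Epimorphism 𝒢 ℋ → Epimorphism (dual 𝒢) (dual ℋ)
dualEpimorphism Φ = record
  { onPoints           = onLines
  ; onLines            = onPoints
  ; preservesIncidence = preservesIncidence
  ; surjectiveOnPoints = surjectiveOnLines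
  ; surjectiveOnLines  = surjectiveOnPoints
  }
  where open Epimorphism Φ

infix 4 _↠_

_↠_ : FiniteThickPlane → OrdinaryTriangle → Set
𝒫 ↠ Δ = Epimorphism (FiniteThickPlane.geometry 𝒫) (OrdinaryTriangle.geometry Δ)

module _ (𝒫 : FiniteThickPlane) (Δ : OrdinaryTriangle) (Φ : 𝒫 ↠ Δ) where
  private
    module 𝒫 = FiniteThickPlane 𝒫
    module Δ = OrdinaryTriangle Δ
  open Epimorphism Φ

  pointFibre : Δ.Point → Pred 𝒫.Point 0ℓ
  pointFibre a = onPoints ⊢ ｛ a ｝

  lineFibre : Δ.Line → Pred 𝒫.Line 0ℓ
  lineFibre ℓ = onLines ⊢ ｛ ℓ ｝

  -- Since Δ has exactly three points, pairwise distinct a, b, c are all of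
  -- them, so choosing them is the same as naming the points of Δ.
  record IsTypeA : Set where
    field
      a b c : Δ.Point
      a≢b   : a ≢ b
      b≢c   : b ≢ c
      a≢c   : a ≢ c
      L     : 𝒫.Line

    Ã = pointFibre a
    B̃ = pointFibre b
    C̃ = pointFibre c

    field
      partition : Partition (𝒫.pointsOn L) Ã B̃
      C̃-affine  : C̃ ≐ ∁ (𝒫.pointsOn L)
      fibre-ab  : lineFibre (Δ.join a≢b) ≐ ｛ L ｝
      fibre-bc  : lineFibre (Δ.join b≢c) ≐
                  λ M → M ≢ L × ∃[ x ] x ∈ B̃ × x 𝒫.I M
      fibre-ac  : lineFibre (Δ.join a≢c) ≐
                  λ M → M ≢ L × ∃[ x ] x ∈ Ã × x 𝒫.I M

IsTypeB : (𝒫 : FiniteThickPlane) (Δ : OrdinaryTriangle) → 𝒫 ↠ Δ → Set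
IsTypeB 𝒫 Δ Φ =
  IsTypeA (dualPlane 𝒫) (dualOrdinaryTriangle Δ) (dualEpimorphism Φ)

{-# OPTIONS --safe #-}

-- Colour each point by the vertex of Δ it is mapped to, and each line by the
-- vertex opposite to the side it is mapped to; incident elements then have
-- different colours.  Projection between a point x and a line L of the same
-- colour i matches the points of colour j on L with the lines of colour k
-- through x, so the number r i k of lines of colour k through a point of colour
-- i does not depend on the point.  Projecting all points from a point of
-- another colour gives r j k * r k j points of colour i and, dually,
-- r j i * r k i lines of colour i, while r i j + r i k = N is one more than the
-- order of the plane.  As the three point classes add up to N² - N + 1 and no
-- r i j vanishes (i ≢ j), this forces r i (i + 1) = 1 for some i and
-- r j (j - 1) = 1 for some j, hence a colour class consisting of a single point
-- or of a single line.  A single line L of its colour yields (a): every point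
-- of a different colour is on a line of L's colour, hence on L.
module Submission where

open import Defs
open import Data.Bool.Base using (if_then_else_)
open import Data.Fin.Base using (Fin; zero; suc; toℕ; punchIn)
open import Data.Fin.Patterns using (0F; 1F; 2F)
open import Data.Fin.Properties using (_≟_; all?; any?; punchInᵢ≢i)
open import Data.List.Base using ([]; _∷_)
open import Data.List.Membership.DecPropositional using (_∈?_)
open import Data.List.Membership.Propositional using () renaming (_∈_ to _∈ᴸ_)
open import Data.Nat.Base using (ℕ; zero; suc; _+_; _*_; _<_)
open import Data.Nat.DivMod using (_%_)
open import Data.Nat.Properties
  using ( +-*-semiring; +-comm; +-identityʳ; +-cancelʳ-≡; *-assoc; *-zeroʳ
        ; m+n≡0⇒m≡0; m+n≡0⇒n≡0; m*n≡0⇒m≡0∨n≡0; n≢0⇒n>0)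
  renaming (_≟_ to _≟ℕ_)
open import Data.Nat.Tactic.RingSolver using (solve-∀)
open import Data.Product using (∃!; ∃-syntax; _×_; _,_; proj₁; proj₂)
open import Data.Sum using (_⊎_; inj₁; inj₂; [_,_]′)
open import Function.Base using (_∘_; flip; const)
open import Function.Bundles using (Inverse)
open import Function.Construct.Identity using (↔-id)
open import Relation.Binary.PropositionalEquality
  using (_≡_; _≢_; refl; sym; trans; cong; cong₂; subst; ≢-sym; module ≡-Reasoning)
open import Relation.Nullary.Decidable
  using (Dec; yes; no; does; dec-true; dec-false; from-yes; map′; ¬?; _×-dec_; _→-dec_)
open import Relation.Nullary.Negation using (¬_; contradiction)
open import Algebra.Properties.Semiring.Sum +-*-semiring
  using (sum; sum-cong-≗; sum-remove; sum-replicate-zero; ∑-distrib-+; ∑-comm; *-distribˡ-sum; *-distribʳ-sum)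

private variable
  X Y A : Set

-- Finite sums

-- The Iverson bracket, through which cardinalities and incidence counts become finite sums.
⟦_⟧ : Dec A → ℕ
⟦ d ⟧ = if does d then 1 else 0

⟦⟧-yes : (d : Dec A) → A → ⟦ d ⟧ ≡ 1
⟦⟧-yes d a rewrite dec-true d a = refl

⟦⟧-no : (d : Dec A) → ¬ A → ⟦ d ⟧ ≡ 0
⟦⟧-no d ¬a rewrite dec-false d ¬a = refl

⟦⟧*-cong : (d : Dec A) {m n : ℕ} → (A → m ≡ n) → ⟦ d ⟧ * m ≡ ⟦ d ⟧ * n
⟦⟧*-cong (yes a) eq = cong (1 *_) (eq a)
⟦⟧*-cong (no _)  eq = refl

⟦⟧*-yes : (d : Dec A) {n : ℕ} → A → ⟦ d ⟧ * n ≡ n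
⟦⟧*-yes d {n} a = trans (cong (_* n) (⟦⟧-yes d a)) (+-identityʳ n)

⟦⟧*-no : (d : Dec A) {n : ℕ} → ¬ A → ⟦ d ⟧ * n ≡ 0
⟦⟧*-no d {n} ¬a = cong (_* n) (⟦⟧-no d ¬a)

⟦⟧*-support : (d : Dec A) {n : ℕ} → ⟦ d ⟧ * n ≢ 0 → A × n ≢ 0
⟦⟧*-support (yes a) nz = a , λ { refl → nz refl }
⟦⟧*-support (no _)  nz = contradiction refl nz

decEq : Finite X → (x y : X) → Dec (x ≡ y)
decEq (_ , e) x y = map′
  (λ eq → trans (sym (strictlyInverseʳ x)) (trans (cong from eq) (strictlyInverseʳ y)))
  (cong to) (to x ≟ to y)
  where open Inverse e

-- Opaque, so that summands can be inferred from sums by unification.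
opaque
  ∑ : Finite X → (X → ℕ) → ℕ
  ∑ (_ , e) f = sum (f ∘ Inverse.from e)

module _ (F : Finite X) where
  opaque
    unfolding ∑

    ∑-cong : {f g : X → ℕ} → (∀ x → f x ≡ g x) → ∑ F f ≡ ∑ F g
    ∑-cong eq = sum-cong-≗ (λ i → eq (Inverse.from (proj₂ F) i))

    ∑-zero : {f : X → ℕ} → (∀ x → f x ≡ 0) → ∑ F f ≡ 0
    ∑-zero eq = trans (∑-cong eq) (sum-replicate-zero (proj₁ F))

    ∑-+ : (f g : X → ℕ) → ∑ F (λ x → f x + g x) ≡ ∑ F f + ∑ F g
    ∑-+ f g = ∑-distrib-+ (f ∘ Inverse.from (proj₂ F)) (g ∘ Inverse.from (proj₂ F))

    *-∑ : ∀ c (f : X → ℕ) → c * ∑ F f ≡ ∑ F (λ x → c * f x)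
    *-∑ c f = *-distribˡ-sum c (f ∘ Inverse.from (proj₂ F))

    ∑-* : ∀ c (f : X → ℕ) → ∑ F f * c ≡ ∑ F (λ x → f x * c)
    ∑-* c f = *-distribʳ-sum c (f ∘ Inverse.from (proj₂ F))

opaque
  unfolding ∑

  ∑-swap : (F : Finite X) (G : Finite Y) (f : X → Y → ℕ) →
    ∑ F (λ x → ∑ G (f x)) ≡ ∑ G (λ y → ∑ F (λ x → f x y))
  ∑-swap (_ , e) (_ , e′) f = ∑-comm (λ i j → f (Inverse.from e i) (Inverse.from e′ j))

  -- Stated additively, since subtraction on ℕ truncates.
  ∑-agree-off : (F : Finite X) {f g : X → ℕ} (x₀ : X) →
    (∀ x → x ≢ x₀ → f x ≡ g x) → ∑ F f + g x₀ ≡ ∑ F g + f x₀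
  ∑-agree-off (zero , e) x₀ _ with () ← Inverse.to e x₀
  ∑-agree-off {X = X} (suc n , e) {f} {g} x₀ agree = begin
    sum (f ∘ from) + g x₀              ≡⟨ cong (_+ g x₀) (split f) ⟩
    f x₀ + rest f + g x₀               ≡⟨ cong (λ r → f x₀ + r + g x₀) (sum-cong-≗ eq) ⟩
    f x₀ + rest g + g x₀               ≡⟨ rotate (f x₀) (rest g) (g x₀) ⟩
    g x₀ + rest g + f x₀               ≡⟨ cong (_+ f x₀) (sym (split g)) ⟩
    sum (g ∘ from) + f x₀              ∎
    where
    open Inverse e
    open ≡-Reasoning
    i : Fin (suc n)
    i = to x₀
    rest : (X → ℕ) → ℕ
    rest h = sum (λ j → h (from (punchIn i j)))
    split : ∀ h → sum (h ∘ from) ≡ h x₀ + rest h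
    split h = trans (sum-remove {i = i} (h ∘ from))
                    (cong (λ z → h z + rest h) (strictlyInverseʳ x₀))
    eq : ∀ j → f (from (punchIn i j)) ≡ g (from (punchIn i j))
    eq j = agree _ λ p → punchInᵢ≢i i j (trans (sym (strictlyInverseˡ _)) (cong to p))
    rotate : ∀ a b c → a + b + c ≡ c + b + a
    rotate = solve-∀

module _ (F : Finite X) {f : X → ℕ} where

  ∑-single : (x₀ : X) → (∀ x → x ≢ x₀ → f x ≡ 0) → ∑ F f ≡ f x₀
  ∑-single x₀ off = trans (sym (+-identityʳ _))
    (trans (∑-agree-off F {g = const 0} x₀ off)
           (cong (_+ f x₀) (∑-zero F {f = const 0} (λ _ → refl))))

  ∑-support : ∑ F f ≢ 0 → ∃[ x ] f x ≢ 0
  ∑-support nz with any? (λ i → ¬? (f (Inverse.from (proj₂ F) i) ≟ℕ 0))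
  ... | yes (i , fi≢0) = Inverse.from (proj₂ F) i , fi≢0
  ... | no  none       = contradiction (∑-zero F vanish) nz
    where
    open Inverse (proj₂ F)
    vanish : ∀ x → f x ≡ 0
    vanish x with f x ≟ℕ 0
    ... | yes eq = eq
    ... | no  ne = contradiction
      (to x , subst (λ z → f z ≢ 0) (sym (strictlyInverseʳ x)) ne) none

  -- `g` is `f` with its value at `x₀` replaced by 0, so a single term splits off without
  -- subtraction.
  ∑-remove : (x₀ : X) → ∃[ g ] (∀ x → x ≢ x₀ → g x ≡ f x) × ∑ F f ≡ ∑ F g + f x₀
  ∑-remove x₀ = g , off , trans (sym (+-identityʳ _))
    (trans (cong (∑ F f +_) (sym (⟦⟧*-no (¬? (x₀ ≟ˣ x₀)) (λ ne → ne refl))))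
           (∑-agree-off F x₀ (λ x ne → sym (off x ne))))
    where
    _≟ˣ_ = decEq F
    g : X → ℕ
    g x = ⟦ ¬? (x ≟ˣ x₀) ⟧ * f x
    off : ∀ x → x ≢ x₀ → g x ≡ f x
    off x ne = ⟦⟧*-yes (¬? (x ≟ˣ x₀)) ne

  ∑≢0 : (x : X) → f x ≢ 0 → ∑ F f ≢ 0
  ∑≢0 x fx≢0 eq with g , _ , split ← ∑-remove x =
    fx≢0 (m+n≡0⇒n≡0 (∑ F g) (trans (sym split) eq))

-- Removing the term at `x` leaves the sum 0, to which a different `y` would still contribute.
∑≡1⇒unique : (F : Finite X) {f : X → ℕ} {x y : X} →
  ∑ F f ≡ 1 → f x ≡ 1 → f y ≢ 0 → y ≡ x
∑≡1⇒unique F {f} {x} {y} total fx fy with decEq F y x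
... | yes y≡x = y≡x
... | no  y≢x = contradiction rest≡0 (∑≢0 F y λ gy → fy (trans (sym (off y y≢x)) gy))
  where
  removed : ∃[ g ] (∀ z → z ≢ x → g z ≡ f z) × ∑ F f ≡ ∑ F g + f x
  removed = ∑-remove F x
  g     = proj₁ removed
  off   = proj₁ (proj₂ removed)
  split = proj₂ (proj₂ removed)
  rest≡0 : ∑ F g ≡ 0
  rest≡0 = +-cancelʳ-≡ 1 (∑ F g) 0
    (trans (cong (∑ F g +_) (sym fx)) (trans (sym split) total))

-- Projective planes

module Incidence (𝒫 : FiniteThickPlane) where
  open FiniteThickPlane 𝒫 public

  _≟ᴾ_ : (x y : Point) → Dec (x ≡ y)
  _≟ᴾ_ = decEq finitePoints

  _≟ᴸ_ : (L M : Line) → Dec (L ≡ M)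
  _≟ᴸ_ = decEq finiteLines

  join-unique : ∀ {x y L M} → x ≢ y → x I L → y I L → x I M → y I M → L ≡ M
  join-unique x≢y xL yL xM yM with uniqueJoin x≢y
  ... | _ , _ , unique = trans (sym (unique (xL , yL))) (unique (xM , yM))

  another-line : ∀ x L → ∃[ M ] M ≢ L × x I M
  another-line x L with thickPoints x
  ... | M , N , _ , M≢N , _ , _ , xM , xN , _ with M ≟ᴸ L
  ... | no  M≢L  = M , M≢L , xM
  ... | yes refl = N , M≢N ∘ sym , xN

  third-point : ∀ L x y → ∃[ z ] z ≢ x × z ≢ y × z I L
  third-point L x y with thickLines L
  ... | p , q , r , p≢q , q≢r , p≢r , pL , qL , rL
    with p ≟ᴾ x | p ≟ᴾ y | q ≟ᴾ x | q ≟ᴾ y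
  ... | no p≢x   | no p≢y   | _        | _        = p , p≢x , p≢y , pL
  ... | _        | _        | no q≢x   | no q≢y   = q , q≢x , q≢y , qL
  ... | yes refl | yes refl | yes refl | _        = contradiction refl p≢q
  ... | yes refl | yes refl | no _     | yes refl = contradiction refl p≢q
  ... | yes refl | no _     | yes refl | _        = contradiction refl p≢q
  ... | yes refl | no _     | no _     | yes refl = r , ≢-sym p≢r , ≢-sym q≢r , rL
  ... | no _     | yes refl | yes refl | _        = r , ≢-sym q≢r , ≢-sym p≢r , rL
  ... | no _     | yes refl | no _     | yes refl = contradiction refl p≢q

  -- A line through x other than L meets L in a single point, so x is on L
  -- exactly when it is that point.
  _I?_ : ∀ x L → Dec (x I L)
  x I? L with another-line x L
  ... | M , M≢L , xM with uniqueMeet M≢L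
  ...   | p , (pM , pL) , unique with p ≟ᴾ x
  ...     | yes refl = yes pL
  ...     | no  p≢x  = no λ xL → p≢x (unique (xM , xL))

-- Counting points and lines

module Through (𝒫 : FiniteThickPlane)
  (_I?_ : ∀ x L → Dec (Geometry._I_ (FiniteThickPlane.geometry 𝒫) x L)) where
  open Incidence 𝒫 hiding (_I?_)

  through : Point → (Line → ℕ) → ℕ
  through x g = ∑ finiteLines λ M → ⟦ x I? M ⟧ * g M

  through-cong : ∀ {x g h} → (∀ {M} → x I M → g M ≡ h M) → through x g ≡ through x h
  through-cong {x} eq = ∑-cong finiteLines λ M → ⟦⟧*-cong (x I? M) eq

  through-+ : ∀ x g h → through x (λ M → g M + h M) ≡ through x g + through x h
  through-+ x g h = trans
    (∑-cong finiteLines λ M → distribute ⟦ x I? M ⟧ (g M) (h M))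
    (∑-+ finiteLines _ _)
    where
    distribute : ∀ a b c → a * (b + c) ≡ a * b + a * c
    distribute = solve-∀

  through-* : ∀ x g c → through x (λ M → g M * c) ≡ through x g * c
  through-* x g c = trans
    (∑-cong finiteLines λ M → sym (*-assoc ⟦ x I? M ⟧ (g M) c))
    (sym (∑-* finiteLines c _))

  -- Only the line joining `x` and `y` contributes to the sum.
  through-join : ∀ {x y c} {g : Line → ℕ} → x ≢ y → (∀ {M} → x I M → y I M → g M ≡ c) →
    through x (λ M → ⟦ y I? M ⟧ * g M) ≡ c
  through-join {x} {y} {g = g} x≢y eq with uniqueJoin x≢y
  ... | J , (xJ , yJ) , unique = trans (∑-single finiteLines J off)
    (trans (⟦⟧*-yes (x I? J) xJ) (trans (⟦⟧*-yes (y I? J) yJ) (eq xJ yJ)))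
    where
    off : ∀ M → M ≢ J → ⟦ x I? M ⟧ * (⟦ y I? M ⟧ * g M) ≡ 0
    off M M≢J with x I? M | y I? M
    ... | no _   | _      = refl
    ... | yes _  | no _   = refl
    ... | yes xM | yes yM = contradiction (sym (unique (xM , yM))) M≢J

-- The decision procedure is a parameter so that a plane and its dual can be counted with the same
-- one; sums over the dual then agree definitionally with those over the plane.
module Counting (𝒫 : FiniteThickPlane)
  (_I?_ : ∀ x L → Dec (Geometry._I_ (FiniteThickPlane.geometry 𝒫) x L)) where
  open Incidence 𝒫 hiding (_I?_) public
  open Through 𝒫 _I?_ public
  open Through (dualPlane 𝒫) (flip _I?_) public using ()
    renaming (through to on; through-cong to on-cong; through-join to on-meet)

  swap-incident : ∀ x (h : Point → ℕ) (g : Point → Line → ℕ) →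
    ∑ finitePoints (λ y → h y * through x (g y)) ≡
    through x (λ M → ∑ finitePoints λ y → h y * g y M)
  swap-incident x h g = begin
    ∑ finitePoints (λ y → h y * through x (g y))
      ≡⟨ ∑-cong finitePoints (λ y → *-∑ finiteLines (h y) _) ⟩
    ∑ finitePoints (λ y → ∑ finiteLines λ M → h y * (⟦ x I? M ⟧ * g y M))
      ≡⟨ ∑-swap finitePoints finiteLines _ ⟩
    ∑ finiteLines (λ M → ∑ finitePoints λ y → h y * (⟦ x I? M ⟧ * g y M))
      ≡⟨ ∑-cong finiteLines (λ M → trans
           (∑-cong finitePoints λ y → exchange (h y) ⟦ x I? M ⟧ (g y M))
           (sym (*-∑ finitePoints ⟦ x I? M ⟧ _))) ⟩
    through x (λ M → ∑ finitePoints λ y → h y * g y M) ∎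
    where
    open ≡-Reasoning
    exchange : ∀ a b c → a * (b * c) ≡ b * (a * c)
    exchange = solve-∀

  -- Projection from x is a bijection between the points of L and the lines
  -- through x.
  perspectivity : ∀ {x L} {f : Point → ℕ} {g : Line → ℕ} → ¬ x I L →
    (∀ {y M} → y I L → x I M → y I M → f y ≡ g M) → on L f ≡ through x g
  perspectivity {x} {L} {f} {g} x∉L eq = begin
    on L f
      ≡⟨ on-cong (λ {y} yL → sym (through-join (λ { refl → x∉L yL }) λ xM yM → sym (eq yL xM yM))) ⟩
    ∑ finitePoints (λ y → ⟦ y I? L ⟧ * through x (λ M → ⟦ y I? M ⟧ * g M))
      ≡⟨ swap-incident x (λ y → ⟦ y I? L ⟧) (λ y M → ⟦ y I? M ⟧ * g M) ⟩
    through x (λ M → on L λ y → ⟦ y I? M ⟧ * g M)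
      ≡⟨ through-cong (λ {M} xM → on-meet (λ { refl → x∉L xM }) λ _ _ → refl) ⟩
    through x g ∎
    where open ≡-Reasoning

  -- The lines through y cover every point other than y once.
  pencil : ∀ y (f : Point → ℕ) →
    through y (λ M → on M f) + f y ≡
    ∑ finitePoints f + through y (λ M → ⟦ y I? M ⟧ * f y)
  pencil y f = trans
    (cong (_+ f y) (trans
      (through-cong λ {M} _ → ∑-cong finitePoints λ x → sym (+-identityʳ _))
      (trans (sym (swap-incident y (const 1) λ x M → ⟦ x I? M ⟧ * f x))
             (∑-cong finitePoints λ x → +-identityʳ _))))
    -- The point `y` itself is on all of these lines rather than on one, hence the correction terms
    -- on both sides.
    (∑-agree-off finitePoints y λ x x≢y → through-join (≢-sym x≢y) λ _ _ → refl)

  degree : Point → ℕ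
  degree x = through x (const 1)

  size : Line → ℕ
  size L = on L (const 1)

  degree≡size : ∀ {x L} → ¬ x I L → degree x ≡ size L
  degree≡size x∉L = sym (perspectivity x∉L λ _ _ _ → refl)

  -- Take a second line through a third point of the line `xy`. A line missing both points allows
  -- their degrees to be compared with the same size.
  line-off : ∀ {x y} → x ≢ y → ∃[ K ] ¬ x I K × ¬ y I K
  line-off {x} {y} x≢y with uniqueJoin x≢y
  ... | L , (xL , yL) , _ with third-point L x y
  ...   | z , z≢x , z≢y , zL with another-line z L
  ...     | K , K≢L , zK =
    K , (λ xK → K≢L (join-unique z≢x zK xK zL xL))
      , (λ yK → K≢L (join-unique z≢y zK yK zL yL))

  point-off : ∀ L → ∃[ x ] ¬ x I L
  point-off L with triangle
  ... | x , y , z , _ , _ , _ , nc with x I? L | y I? L | z I? L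
  ... | no x∉L | _      | _      = x , x∉L
  ... | _      | no y∉L | _      = y , y∉L
  ... | _      | _      | no z∉L = z , z∉L
  ... | yes xL | yes yL | yes zL = contradiction (xL , yL , zL) (nc L)

  -- Read off at an arbitrary point; `degree≡` and `size≡` show that every point and every line
  -- gives the same number.
  order+1 : ℕ
  order+1 = degree (proj₁ triangle)

  degree≡ : ∀ x → degree x ≡ order+1
  degree≡ x with x ≟ᴾ proj₁ triangle
  ... | yes refl = refl
  ... | no x≢x₀ with _ , x∉K , x₀∉K ← line-off x≢x₀ =
    trans (degree≡size x∉K) (sym (degree≡size x₀∉K))

  size≡ : ∀ L → size L ≡ order+1
  size≡ L with x , x∉L ← point-off L = trans (sym (degree≡size x∉L)) (degree≡ x)

  -- This is `pencil` for the constant 1: the lines through a point carry `order+1` points each, and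
  -- the point itself is counted on each of them.
  number-of-points :
    ∑ finitePoints (const 1) + order+1 ≡ order+1 * order+1 + 1
  number-of-points = begin
    ∑ finitePoints (const 1) + order+1
      ≡⟨ cong (_ +_) (sym (degree≡ x)) ⟩
    ∑ finitePoints (const 1) + through x (const 1)
      ≡⟨ cong (_ +_) (through-cong λ {M} xM → sym (⟦⟧*-yes (x I? M) xM)) ⟩
    ∑ finitePoints (const 1) + through x (λ M → ⟦ x I? M ⟧ * 1)
      ≡⟨ pencil x (const 1) ⟨
    through x size + 1
      ≡⟨ cong (_+ 1) (through-cong λ {M} _ → trans (size≡ M) (sym (+-identityʳ _))) ⟩
    through x (λ _ → 1 * order+1) + 1
      ≡⟨ cong (_+ 1) (through-* x (const 1) order+1) ⟩
    degree x * order+1 + 1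
      ≡⟨ cong (λ d → d * order+1 + 1) (degree≡ x) ⟩
    order+1 * order+1 + 1 ∎
    where
    open ≡-Reasoning
    x = proj₁ triangle

-- Three colours

Colour : Set
Colour = Fin 3

Distinct : Colour → Colour → Colour → Set
Distinct i j k = i ≢ j × j ≢ k × i ≢ k

private
  distinct? : ∀ i j k → Dec (Distinct i j k)
  distinct? i j k = ¬? (i ≟ j) ×-dec ¬? (j ≟ k) ×-dec ¬? (i ≟ k)

rotate : ∀ {i j k} → Distinct i j k → Distinct j k i
rotate (i≢j , j≢k , i≢k) = j≢k , ≢-sym i≢k , ≢-sym i≢j

reflect : ∀ {i j k} → Distinct i j k → Distinct k j i
reflect (i≢j , j≢k , i≢k) = ≢-sym j≢k , ≢-sym i≢j , ≢-sym i≢k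

remaining : ∀ {i j k} → Distinct i j k → ∀ {l} → l ≢ i → l ≢ j → l ≡ k
remaining {i} {j} {k} d {l} = from-yes
  (all? λ i → all? λ j → all? λ k → all? λ l →
    distinct? i j k →-dec ¬? (l ≟ i) →-dec ¬? (l ≟ j) →-dec (l ≟ k)) i j k l d

third : ∀ {i j} → i ≢ j → ∃[ k ] Distinct i j k
third {i} {j} = from-yes
  (all? λ i → all? λ j → ¬? (i ≟ j) →-dec any? λ k → distinct? i j k) i j

others : ∀ k → ∃[ i ] ∃[ j ] Distinct i j k
others = from-yes (all? λ k → any? λ i → any? λ j → distinct? i j k)

-- Writing uᵢ = aᵢ + 1, vᵢ = bᵢ + 1 and N = m + 2, so that aᵢ + bᵢ = m, the
-- last hypothesis becomes a₂b₃ + a₃b₁ + a₁b₂ = m².  Expanding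
-- m³ = (a₁ + b₁)(a₂ + b₂)(a₃ + b₃) = a₁a₂a₃ + b₁b₂b₃ + m(a₂b₃ + a₃b₁ + a₁b₂)
-- leaves a₁a₂a₃ = b₁b₂b₃ = 0.
unit-product : ∀ {u₁ u₂ u₃ v₁ v₂ v₃ N} →
  0 < u₁ → 0 < u₂ → 0 < u₃ → 0 < v₁ → 0 < v₂ → 0 < v₃ →
  u₁ + v₁ ≡ N → u₂ + v₂ ≡ N → u₃ + v₃ ≡ N →
  u₂ * v₃ + u₃ * v₁ + u₁ * v₂ + N ≡ N * N + 1 →
  (u₂ * v₃ ≡ 1 ⊎ u₃ * v₁ ≡ 1 ⊎ u₁ * v₂ ≡ 1) ⊎
  (v₂ * u₃ ≡ 1 ⊎ v₃ * u₁ ≡ 1 ⊎ v₁ * u₂ ≡ 1)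
unit-product {suc a₁} {suc a₂} {suc a₃} {suc b₁} {suc b₂} {suc b₃} {N}
  _ _ _ _ _ _ N₁ N₂ N₃ total =
  conclude (zero-factor (m+n≡0⇒m≡0 (a₁ * a₂ * a₃) products≡0))
           (zero-factor (m+n≡0⇒n≡0 (a₁ * a₂ * a₃) products≡0))
  where
  m = a₁ + b₁
  E = a₂ * b₃ + a₃ * b₁ + a₁ * b₂

  same : ∀ {a b} → suc a + suc b ≡ N → a + b ≡ m
  same {a} {b} eq = +-cancelʳ-≡ 2 (a + b) m
    (trans (sym (shift a b)) (trans eq (trans (sym N₁) (shift a₁ b₁))))
    where
    shift : ∀ a b → suc a + suc b ≡ a + b + 2
    shift = solve-∀

  E≡m² : E ≡ m * m
  -- The three products exceed `E` by `3m + 3` and `N` is `m + 2`, which gives `4m + 5`; likewise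
  -- `N * N + 1` exceeds `m * m` by `4m + 5`.
  E≡m² = +-cancelʳ-≡ (4 * m + 5) E (m * m) (begin
    E + (4 * m + 5)
      ≡⟨ cong (λ t → E + (t + 5)) (triple m) ⟩
    E + (m + m + m + m + 5)
      ≡⟨ cong₂ (λ s t → E + (m + m + s + t + 5)) (sym (same N₂)) (sym (same N₃)) ⟩
    E + (m + m + (a₂ + b₂) + (a₃ + b₃) + 5)
      ≡⟨ left a₁ a₂ a₃ b₁ b₂ b₃ ⟩
    suc a₂ * suc b₃ + suc a₃ * suc b₁ + suc a₁ * suc b₂ + (suc a₁ + suc b₁)
      ≡⟨ subst (λ N → suc a₂ * suc b₃ + suc a₃ * suc b₁ + suc a₁ * suc b₂ + N ≡ N * N + 1) (sym N₁) total ⟩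
    (suc a₁ + suc b₁) * (suc a₁ + suc b₁) + 1
      ≡⟨ right a₁ b₁ ⟩
    m * m + (4 * m + 5) ∎)
    where
    open ≡-Reasoning
    triple : ∀ m → 4 * m ≡ m + m + m + m
    triple = solve-∀
    left : ∀ a₁ a₂ a₃ b₁ b₂ b₃ →
      a₂ * b₃ + a₃ * b₁ + a₁ * b₂ + (a₁ + b₁ + (a₁ + b₁) + (a₂ + b₂) + (a₃ + b₃) + 5) ≡
      suc a₂ * suc b₃ + suc a₃ * suc b₁ + suc a₁ * suc b₂ + (suc a₁ + suc b₁)
    left = solve-∀
    right : ∀ a b → (suc a + suc b) * (suc a + suc b) + 1 ≡ (a + b) * (a + b) + (4 * (a + b) + 5)
    right = solve-∀

  products≡0 : a₁ * a₂ * a₃ + b₁ * b₂ * b₃ ≡ 0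
  products≡0 = +-cancelʳ-≡ (m * E) _ 0 (begin
    a₁ * a₂ * a₃ + b₁ * b₂ * b₃ + m * E
      ≡⟨ cong (λ t → a₁ * a₂ * a₃ + b₁ * b₂ * b₃ + t) (expand m (a₂ * b₃) (a₃ * b₁) (a₁ * b₂)) ⟩
    a₁ * a₂ * a₃ + b₁ * b₂ * b₃ + (m * (a₂ * b₃) + m * (a₃ * b₁) + m * (a₁ * b₂))
      ≡⟨ cong₂ (λ s t → a₁ * a₂ * a₃ + b₁ * b₂ * b₃ + (m * (a₂ * b₃) + s * (a₃ * b₁) + t * (a₁ * b₂)))
           (sym (same N₂)) (sym (same N₃)) ⟩
    a₁ * a₂ * a₃ + b₁ * b₂ * b₃ + (m * (a₂ * b₃) + (a₂ + b₂) * (a₃ * b₁) + (a₃ + b₃) * (a₁ * b₂))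
      ≡⟨ cube a₁ a₂ a₃ b₁ b₂ b₃ ⟩
    m * ((a₂ + b₂) * (a₃ + b₃))
      ≡⟨ cong₂ (λ s t → m * (s * t)) (same N₂) (same N₃) ⟩
    m * (m * m)
      ≡⟨ cong (m *_) (sym E≡m²) ⟩
    m * E ∎)
    where
    open ≡-Reasoning
    expand : ∀ m x y z → m * (x + y + z) ≡ m * x + m * y + m * z
    expand = solve-∀
    cube : ∀ a₁ a₂ a₃ b₁ b₂ b₃ →
      a₁ * a₂ * a₃ + b₁ * b₂ * b₃ +
        ((a₁ + b₁) * (a₂ * b₃) + (a₂ + b₂) * (a₃ * b₁) + (a₃ + b₃) * (a₁ * b₂)) ≡
      (a₁ + b₁) * ((a₂ + b₂) * (a₃ + b₃))
    cube = solve-∀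

  zero-factor : ∀ {x y z} → x * y * z ≡ 0 → x ≡ 0 ⊎ y ≡ 0 ⊎ z ≡ 0
  zero-factor {x} {y} eq with m*n≡0⇒m≡0∨n≡0 (x * y) eq
  ... | inj₂ z≡0 = inj₂ (inj₂ z≡0)
  ... | inj₁ xy≡0 with m*n≡0⇒m≡0∨n≡0 x xy≡0
  ...   | inj₁ x≡0 = inj₁ x≡0
  ...   | inj₂ y≡0 = inj₂ (inj₁ y≡0)

  unit : ∀ {x y} → x ≡ 0 → y ≡ 0 → suc x * suc y ≡ 1
  unit refl refl = refl

  -- A vanishing `a` and a vanishing `b` with different indices give one of the six alternatives
  -- directly. With equal indices they force `m` to be 0, so a `b` with another index vanishes as
  -- well.
  degenerate : ∀ {a b a′ b′} → a ≡ 0 → b ≡ 0 → a + b ≡ m → a′ + b′ ≡ m → b′ ≡ 0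
  degenerate {a′ = a′} refl refl eq eq′ = m+n≡0⇒n≡0 a′ (trans eq′ (sym eq))

  conclude : a₁ ≡ 0 ⊎ a₂ ≡ 0 ⊎ a₃ ≡ 0 → b₁ ≡ 0 ⊎ b₂ ≡ 0 ⊎ b₃ ≡ 0 → _
  conclude (inj₁ a₁≡0)        (inj₁ b₁≡0)        =
    inj₁ (inj₂ (inj₂ (unit a₁≡0 (degenerate a₁≡0 b₁≡0 refl (same N₂)))))
  conclude (inj₁ a₁≡0)        (inj₂ (inj₁ b₂≡0)) = inj₁ (inj₂ (inj₂ (unit a₁≡0 b₂≡0)))
  conclude (inj₁ a₁≡0)        (inj₂ (inj₂ b₃≡0)) = inj₂ (inj₂ (inj₁ (unit b₃≡0 a₁≡0)))
  conclude (inj₂ (inj₁ a₂≡0)) (inj₁ b₁≡0)        = inj₂ (inj₂ (inj₂ (unit b₁≡0 a₂≡0)))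
  conclude (inj₂ (inj₁ a₂≡0)) (inj₂ (inj₁ b₂≡0)) =
    inj₁ (inj₁ (unit a₂≡0 (degenerate a₂≡0 b₂≡0 (same N₂) (same N₃))))
  conclude (inj₂ (inj₁ a₂≡0)) (inj₂ (inj₂ b₃≡0)) = inj₁ (inj₁ (unit a₂≡0 b₃≡0))
  conclude (inj₂ (inj₂ a₃≡0)) (inj₁ b₁≡0)        = inj₁ (inj₂ (inj₁ (unit a₃≡0 b₁≡0)))
  conclude (inj₂ (inj₂ a₃≡0)) (inj₂ (inj₁ b₂≡0)) = inj₂ (inj₁ (unit b₂≡0 a₃≡0))
  conclude (inj₂ (inj₂ a₃≡0)) (inj₂ (inj₂ b₃≡0)) =
    inj₁ (inj₂ (inj₁ (unit a₃≡0 (degenerate a₃≡0 b₃≡0 (same N₃) refl))))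

-- Counting in a properly coloured plane

δ : Colour → Colour → ℕ
δ i l = ⟦ i ≟ l ⟧

δ≢0 : ∀ {i l} → l ≡ i → δ i l ≢ 0
δ≢0 {i} refl δ≡0 = contradiction (trans (sym (⟦⟧-yes (i ≟ i) refl)) δ≡0) λ ()

δ≢0⇒≡ : ∀ {i l} → δ i l ≢ 0 → l ≡ i
δ≢0⇒≡ {i} {l} nz with i ≟ l
... | yes i≡l = sym i≡l
... | no  _   = contradiction refl nz

-- The colours `l` and `m` are `j` and `k` in some order, so `l` is `j` exactly when `m` is `k`.
δ-transfer : ∀ {i j k} → Distinct i j k → ∀ {l m} → l ≢ i → m ≢ i → l ≢ m → δ j l ≡ δ k m
δ-transfer {i} {j} {k} d {l} {m} l≢i m≢i l≢m with j ≟ l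
... | yes refl = sym (⟦⟧-yes (k ≟ m) (sym (remaining d m≢i (≢-sym l≢m))))
... | no  j≢l  = sym (⟦⟧-no (k ≟ m) λ { refl → l≢m (remaining d l≢i (≢-sym j≢l)) })

δ-complement : ∀ {i j k} → Distinct i j k → ∀ {l} → l ≢ i → δ j l + δ k l ≡ 1
δ-complement {i} {j} {k} d {l} l≢i with j ≟ l
... | yes refl = cong suc (⟦⟧-no (k ≟ j) (≢-sym (proj₁ (proj₂ d))))
... | no  j≢l  = ⟦⟧-yes (k ≟ l) (sym (remaining d l≢i (≢-sym j≢l)))

δ-total : ∀ l → δ 0F l + δ 1F l + δ 2F l ≡ 1
δ-total = from-yes (all? λ l → δ 0F l + δ 1F l + δ 2F l ≟ℕ 1)

-- All that the counting uses of an epimorphism. The conditions are symmetric in points and lines,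
-- so dualising merely exchanges `κ` and `ℓ`.
record Colouring (𝒫 : FiniteThickPlane) : Set where
  open FiniteThickPlane 𝒫
  field
    κ      : Point → Colour
    ℓ      : Line → Colour
    proper : ∀ {x L} → x I L → κ x ≢ ℓ L
    κ-onto : ∀ i → ∃[ x ] κ x ≡ i
    ℓ-onto : ∀ i → ∃[ L ] ℓ L ≡ i

dualColouring : ∀ {𝒫} → Colouring 𝒫 → Colouring (dualPlane 𝒫)
dualColouring C = record
  { κ = ℓ ; ℓ = κ ; proper = λ xL → ≢-sym (proper xL) ; κ-onto = ℓ-onto ; ℓ-onto = κ-onto }
  where open Colouring C

module ColourCounting (𝒫 : FiniteThickPlane)
  (_I?_ : ∀ x L → Dec (Geometry._I_ (FiniteThickPlane.geometry 𝒫) x L))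
  (C : Colouring 𝒫) where
  open Counting 𝒫 _I?_ public
  open Colouring C public

  -- Counted at an arbitrary point or line of colour i; by through≡r and on≡r
  -- the choice does not matter.
  r s : Colour → Colour → ℕ
  r i k = through (proj₁ (κ-onto i)) (δ k ∘ ℓ)
  s i k = on (proj₁ (ℓ-onto i)) (δ k ∘ κ)

  -- `x` is not on `L`, since their colours agree. For `y` on `L`, neither `y` nor the line `xy` has
  -- colour `i`, and their colours differ, so `perspectivity` applies with `δ-transfer`.
  on≡through : ∀ {i j k} → Distinct i j k → ∀ {x L} → κ x ≡ i → ℓ L ≡ i →
    on L (δ j ∘ κ) ≡ through x (δ k ∘ ℓ)
  on≡through d κx ℓL = perspectivity (λ xL → proper xL (trans κx (sym ℓL)))
    λ yL xM yM → δ-transfer d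
      (λ κy → proper yL (trans κy (sym ℓL)))
      (λ ℓM → proper xM (trans κx (sym ℓM)))
      (proper yM)

  on≡r : ∀ {i j k} → Distinct i j k → ∀ {L} → ℓ L ≡ i → on L (δ j ∘ κ) ≡ r i k
  on≡r {i} d ℓL = on≡through d (proj₂ (κ-onto i)) ℓL

  through≡r : ∀ {i j k} → Distinct i j k → ∀ {x} → κ x ≡ i → through x (δ k ∘ ℓ) ≡ r i k
  through≡r {i} d κx = trans (sym (on≡through d κx (proj₂ (ℓ-onto i)))) (on≡r d (proj₂ (ℓ-onto i)))

  s≡r : ∀ {i j k} → Distinct i j k → s i j ≡ r i k
  s≡r {i} d = on≡r d (proj₂ (ℓ-onto i))

  r-complement : ∀ {i j k} → Distinct i j k → r i j + r i k ≡ order+1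
  r-complement {i} d with x , κx ← κ-onto i = trans (sym (through-+ x _ _)) (trans
    (through-cong λ xM → δ-complement d λ ℓM → proper xM (trans κx (sym ℓM)))
    (degree≡ x))

  -- From a point `y` of colour `j`, the points of colour `i` are seen only along lines of colour
  -- `k`: no line through `y` has colour `j`, and no line of colour `i` has a point of colour `i`.
  -- There are `r j k` such lines, with `r k j` points of colour `i` each.
  points-of-colour : ∀ {i j k} → Distinct i j k → ∑ finitePoints (δ i ∘ κ) ≡ r j k * r k j
  points-of-colour {i} {j} {k} d@(i≢j , _ , _) = begin
    ∑ finitePoints f
      ≡⟨ +-identityʳ _ ⟨
    ∑ finitePoints f + 0
      ≡⟨ cong (∑ finitePoints f +_) (∑-zero finiteLines λ M →
           trans (cong (⟦ y I? M ⟧ *_) (trans (cong (⟦ y I? M ⟧ *_) fy≡0) (*-zeroʳ ⟦ y I? M ⟧)))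
                 (*-zeroʳ ⟦ y I? M ⟧)) ⟨
    ∑ finitePoints f + through y (λ M → ⟦ y I? M ⟧ * f y)
      ≡⟨ pencil y f ⟨
    through y (λ M → on M f) + f y
      ≡⟨ trans (cong (through y (λ M → on M f) +_) fy≡0) (+-identityʳ _) ⟩
    through y (λ M → on M f)
      ≡⟨ through-cong (λ yM → on-line λ ℓM → proper yM (trans κy (sym ℓM))) ⟩
    through y (λ M → δ k (ℓ M) * r k j)
      ≡⟨ through-* y (δ k ∘ ℓ) (r k j) ⟩
    through y (δ k ∘ ℓ) * r k j
      ≡⟨ cong (_* r k j) (through≡r (rotate d′) κy) ⟩
    r j k * r k j ∎
    where
    open ≡-Reasoning
    y  = proj₁ (κ-onto j)
    κy = proj₂ (κ-onto j)
    f : Point → ℕ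
    f = δ i ∘ κ
    d′ : Distinct k j i
    d′ = reflect d
    -- This makes both correction terms of `pencil` vanish.
    fy≡0 : f y ≡ 0
    fy≡0 = ⟦⟧-no (i ≟ κ y) λ i≡κy → i≢j (trans i≡κy κy)
    on-line : ∀ {M} → ℓ M ≢ j → on M f ≡ δ k (ℓ M) * r k j
    on-line {M} ℓM≢j with k ≟ ℓ M
    ... | yes k≡ℓM = trans (on≡r (rotate (rotate d)) (sym k≡ℓM)) (sym (+-identityʳ _))
    ... | no  k≢ℓM = ∑-zero finitePoints λ x → off-line x
      where
      ℓM≡i : ℓ M ≡ i
      ℓM≡i = remaining d′ (≢-sym k≢ℓM) ℓM≢j
      off-line : ∀ x → ⟦ x I? M ⟧ * f x ≡ 0
      off-line x with x I? M
      ... | no _   = refl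
      ... | yes xM = trans (+-identityʳ _)
        (⟦⟧-no (i ≟ κ x) λ i≡κx → proper xM (trans (sym i≡κx) (sym ℓM≡i)))

  -- `r j k` is a factor of the number of points of the third colour, which is nonzero because that
  -- colour occurs.
  r≢0 : ∀ {j k} → j ≢ k → r j k ≢ 0
  r≢0 {j} {k} j≢k r≡0 with i , d ← third j≢k =
    ∑≢0 finitePoints (proj₁ (κ-onto i)) (δ≢0 (proj₂ (κ-onto i)))
      (trans (points-of-colour (rotate (rotate d))) (cong (_* r k j) r≡0))

  -- The three colour classes partition the points. This is the last hypothesis of `unit-product`.
  total : r 1F 2F * r 2F 1F + r 2F 0F * r 0F 2F + r 0F 1F * r 1F 0F + order+1 ≡
          order+1 * order+1 + 1
  total = trans (cong (_+ order+1) (begin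
    r 1F 2F * r 2F 1F + r 2F 0F * r 0F 2F + r 0F 1F * r 1F 0F
      ≡⟨ cong₂ _+_ (cong₂ _+_ (points-of-colour {0F} {1F} {2F} ((λ ()) , (λ ()) , (λ ())))
                              (points-of-colour {1F} {2F} {0F} ((λ ()) , (λ ()) , (λ ()))))
                   (points-of-colour {2F} {0F} {1F} ((λ ()) , (λ ()) , (λ ()))) ⟨
    ∑ finitePoints (δ 0F ∘ κ) + ∑ finitePoints (δ 1F ∘ κ) + ∑ finitePoints (δ 2F ∘ κ)
      ≡⟨ trans (∑-+ finitePoints _ _) (cong (_+ ∑ finitePoints (δ 2F ∘ κ)) (∑-+ finitePoints _ _)) ⟨
    ∑ finitePoints (λ x → δ 0F (κ x) + δ 1F (κ x) + δ 2F (κ x))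
      ≡⟨ ∑-cong finitePoints (λ x → δ-total (κ x)) ⟩
    ∑ finitePoints (const 1) ∎)) number-of-points
    where open ≡-Reasoning

  unique-point : ∀ i → ∑ finitePoints (δ i ∘ κ) ≡ 1 → ∃[ x ] (∀ y → κ y ≡ κ x → y ≡ x)
  unique-point i one = x , λ y κy → ∑≡1⇒unique finitePoints {f = δ i ∘ κ} one
    (⟦⟧-yes (i ≟ κ x) (sym κx)) (δ≢0 (trans κy κx))
    where
    x  = proj₁ (κ-onto i)
    κx = proj₂ (κ-onto i)

  -- The number of such lines through `x` is nonzero by `r≢0`, so some term of the sum supplies a
  -- witness.
  line-of-colour : ∀ {x k} → κ x ≢ k → ∃[ M ] x I M × ℓ M ≡ k
  line-of-colour {x} {k} κx≢k = M , proj₁ supported , δ≢0⇒≡ (proj₂ supported)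
    where
    d = reflect (rotate (proj₂ (third κx≢k)))
    line : ∃[ M ] ⟦ x I? M ⟧ * δ k (ℓ M) ≢ 0
    line = ∑-support finiteLines λ eq → r≢0 κx≢k (trans (sym (through≡r d refl)) eq)
    M = proj₁ line
    supported : x I M × δ k (ℓ M) ≢ 0
    supported = ⟦⟧*-support (x I? M) (proj₂ line)

-- Duality and colour classes with a single element

module _ (𝒫 : FiniteThickPlane) (C : Colouring 𝒫) where
  open Incidence 𝒫 using (_I?_)
  open ColourCounting 𝒫 _I?_ C
  private module Dual = ColourCounting (dualPlane 𝒫) (flip _I?_) (dualColouring C)

  -- The dual of `r` is `s`, and `s≡r` translates the dual count back.
  lines-of-colour : ∀ {i j k} → Distinct i j k → ∑ finiteLines (δ i ∘ ℓ) ≡ r j i * r k i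
  lines-of-colour d = trans (Dual.points-of-colour d)
    (cong₂ _*_ (s≡r (rotate d)) (s≡r (reflect d)))

  unique-point-or-line :
    (∃[ L ] ∀ M → ℓ M ≡ ℓ L → M ≡ L) ⊎ (∃[ x ] ∀ y → κ y ≡ κ x → y ≡ x)
  unique-point-or-line =
    [ inj₂ ∘ [ unique-point 0F ∘ trans (points-of-colour d₀)
             , [ unique-point 1F ∘ trans (points-of-colour d₁)
               , unique-point 2F ∘ trans (points-of-colour d₂) ]′ ]′
    , inj₁ ∘ [ Dual.unique-point 0F ∘ trans (lines-of-colour d₀)
             , [ Dual.unique-point 1F ∘ trans (lines-of-colour d₁)
               , Dual.unique-point 2F ∘ trans (lines-of-colour d₂) ]′ ]′ ]′ (unit-product
    -- The `uᵢ` are the values of `r` from a colour to its cyclic successor, the `vᵢ` those to its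
    -- predecessor. The six products are then the sizes of the point classes and of the line
    -- classes.
    (pos {0F} {1F} λ ()) (pos {1F} {2F} λ ()) (pos {2F} {0F} λ ())
    (pos {0F} {2F} λ ()) (pos {1F} {0F} λ ()) (pos {2F} {1F} λ ())
    (r-complement d₀) (r-complement d₁) (r-complement d₂) total)
    where
    pos : ∀ {i j} → i ≢ j → 0 < r i j
    pos i≢j = n≢0⇒n>0 (r≢0 i≢j)
    d₀ : Distinct 0F 1F 2F
    d₀ = (λ ()) , (λ ()) , (λ ())
    d₁ : Distinct 1F 2F 0F
    d₁ = rotate d₀
    d₂ : Distinct 2F 0F 1F
    d₂ = rotate d₁

  module UniqueLine {L : Line} (unique : ∀ M → ℓ M ≡ ℓ L → M ≡ L) where

    on-unique-line : ∀ {x} → κ x ≢ ℓ L → x I L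
    on-unique-line {x} κx≢ℓL = subst (x I_) (unique M ℓM) xM
      where
      line = line-of-colour κx≢ℓL
      M  = proj₁ line
      xM = proj₁ (proj₂ line)
      ℓM = proj₂ (proj₂ line)

    -- The intersection of `M` with `L` has neither the colour of `M` nor that of `L`.
    meets-in : ∀ {i j} → Distinct i j (ℓ L) → ∀ {M} → ℓ M ≡ i →
      M ≢ L × ∃[ x ] κ x ≡ j × x I M
    meets-in {i} {j} d@(_ , _ , i≢ℓL) {M} ℓM = M≢L , x ,
      remaining (rotate (rotate d)) (proper xL) (λ κx → proper xM (trans κx (sym ℓM))) , xM
      where
      M≢L : M ≢ L
      M≢L refl = i≢ℓL (sym ℓM)
      meeting = uniqueMeet M≢L
      x  = proj₁ meeting
      xM = proj₁ (proj₁ (proj₂ meeting))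
      xL = proj₂ (proj₁ (proj₂ meeting))

    -- `M` has neither the colour of `x` nor that of `L`, as `L` is alone in its class.
    colour-from-point : ∀ {i j} → Distinct i j (ℓ L) → ∀ {x M} → M ≢ L → κ x ≡ j → x I M → ℓ M ≡ i
    colour-from-point d M≢L κx xM = remaining (rotate d)
      (λ ℓM → proper xM (trans κx (sym ℓM))) (λ ℓM → M≢L (unique _ ℓM))

-- Epimorphisms onto the triangle

module Triangle (Δ : OrdinaryTriangle) where
  open OrdinaryTriangle Δ public

  vertex : Colour → Point
  vertex = Inverse.from threePoints

  colour : Point → Colour
  colour = Inverse.to threePoints

  colour-vertex : ∀ i → colour (vertex i) ≡ i
  colour-vertex = Inverse.strictlyInverseˡ threePoints

  vertex-colour : ∀ x → vertex (colour x) ≡ x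
  vertex-colour = Inverse.strictlyInverseʳ threePoints

  colour-injective : ∀ {x y} → colour x ≡ colour y → x ≡ y
  colour-injective eq = trans (sym (vertex-colour _)) (trans (cong vertex eq) (vertex-colour _))

  vertex-≢ : ∀ {i j} → i ≢ j → vertex i ≢ vertex j
  vertex-≢ i≢j eq = i≢j (trans (sym (colour-vertex _)) (trans (cong colour eq) (colour-vertex _)))

  -- A line has exactly two of the three points, so being on it amounts to differing from the
  -- remaining one.
  opposite : ∀ m → ∃[ i ] (∀ {x} → x I m → colour x ≢ i) × (∀ {x} → colour x ≢ i → x I m)
  opposite m with thinLines m
  ... | x , y , x≢y , on⇒ , on⇐ with third (x≢y ∘ colour-injective)
  ...   | k , d@(_ , cy≢k , cx≢k) = k , (λ z∈m → misses (on⇒ z∈m)) , covers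
    where
    misses : ∀ {z} → x ≡ z ⊎ y ≡ z → colour z ≢ k
    misses (inj₁ refl) = cx≢k
    misses (inj₂ refl) = cy≢k
    covers : ∀ {z} → colour z ≢ k → z I m
    covers {z} cz≢k with colour x ≟ colour z
    ... | yes eq = on⇐ (inj₁ (colour-injective eq))
    ... | no  ne = on⇐ (inj₂ (colour-injective (sym (remaining (rotate (rotate d)) cz≢k (≢-sym ne)))))

  opp : Line → Colour
  opp m = proj₁ (opposite m)

  on⇒≢opp : ∀ {x m} → x I m → colour x ≢ opp m
  on⇒≢opp {m = m} = proj₁ (proj₂ (opposite m))

  ≢opp⇒on : ∀ {x m} → colour x ≢ opp m → x I m
  ≢opp⇒on {m = m} = proj₂ (proj₂ (opposite m))

  -- Two lines missing the same vertex share the other two, whose join is unique.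
  opp-injective : ∀ {m n} → opp m ≡ opp n → m ≡ n
  opp-injective {m} {n} eq = determined (thinLines m)
    where
    transfer : ∀ {z} → z I m → z I n
    transfer z∈m = ≢opp⇒on λ cz → on⇒≢opp z∈m (trans cz (sym eq))
    determined : ExactlyTwo (pointsOn m) → m ≡ n
    determined (x , y , x≢y , _ , on⇐) =
      trans (sym (unique (xm , ym))) (unique (transfer xm , transfer ym))
      where
      xm = on⇐ (inj₁ refl)
      ym = on⇐ (inj₂ refl)
      unique = proj₂ (proj₂ (uniqueJoin x≢y))

  opp-join : ∀ {x y k} (x≢y : x ≢ y) → Distinct (colour x) (colour y) k → opp (join x≢y) ≡ k
  opp-join x≢y d with uniqueJoin x≢y
  ... | m , (xm , ym) , _ = remaining d (≢-sym (on⇒≢opp xm)) (≢-sym (on⇒≢opp ym))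

  opp-side : ∀ {i j k} (i≢j : i ≢ j) → Distinct i j k → opp (join (vertex-≢ i≢j)) ≡ k
  opp-side {i} {j} i≢j (_ , j≢k , i≢k) = opp-join (vertex-≢ i≢j)
    ( (λ eq → vertex-≢ i≢j (colour-injective eq))
    , (λ eq → j≢k (trans (sym (colour-vertex j)) eq))
    , (λ eq → i≢k (trans (sym (colour-vertex i)) eq)))

  opp-onto : ∀ k → ∃[ m ] opp m ≡ k
  opp-onto k = let i , j , d = others k in
    join (vertex-≢ (proj₁ d)) , opp-side (proj₁ d) d

-- Classification and existence of the epimorphisms

module _ (𝒫 : FiniteThickPlane) (Δ : OrdinaryTriangle) (Φ : 𝒫 ↠ Δ) where
  open Epimorphism Φ
  private
    module 𝒫 = FiniteThickPlane 𝒫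
    module Δ = Triangle Δ

  colouring : Colouring 𝒫
  colouring = record
    { κ      = Δ.colour ∘ onPoints
    ; ℓ      = Δ.opp ∘ onLines
    ; proper = λ xL → Δ.on⇒≢opp (preservesIncidence xL)
    ; κ-onto = λ i → let x , eq = surjectiveOnPoints (Δ.vertex i) in
                     x , trans (cong Δ.colour eq) (Δ.colour-vertex i)
    ; ℓ-onto = λ i → let m , oppm = Δ.opp-onto i ; L , eq = surjectiveOnLines m in
                     L , trans (cong Δ.opp eq) oppm
    }

  -- The vertex opposite to the image of `L` serves as `c`. Uniqueness refers to images rather than
  -- colours because the dual triangle numbers its vertices by `threeLines`, independently of `opp`.
  unique-line⇒typeA : ∃[ L ] (∀ M → onLines M ≡ onLines L → M ≡ L) → IsTypeA 𝒫 Δ Φ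
  unique-line⇒typeA (L , unique) = record
    { a         = Δ.vertex i
    ; b         = Δ.vertex j
    ; c         = Δ.vertex k
    ; a≢b       = Δ.vertex-≢ i≢j
    ; b≢c       = Δ.vertex-≢ j≢k
    ; a≢c       = Δ.vertex-≢ i≢k
    ; L         = L
    ; partition = ((λ {x} → on⇒ x) , λ {x} → [ on⇐ i≢k , on⇐ j≢k ]′)
                , (λ (p , q) → Δ.vertex-≢ i≢j (trans p (sym q)))
                , satisfiable i , satisfiable j
    ; C̃-affine  = (λ p xL → proper xL (sym (colour-of p)))
               , (λ {x} x∉L → fibre (off x x∉L))
    ; fibre-ab  = (λ {M} p → sym (U M (line-colour i≢j d p)))
               , (λ { refl → line-fibre i≢j d refl })
    -- A line over the side `bc` has the colour of `a`, so it meets `L` in a point over `b`.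
    ; fibre-bc  = (λ p → covered (meets-in d (line-colour j≢k (rotate d) p)))
               , (λ (M≢L , x , x∈B , xM) →
                   line-fibre j≢k (rotate d) (colour-from-point d M≢L (sym (colour-of x∈B)) xM))
    ; fibre-ac  = (λ p → covered (meets-in d′ (line-colour i≢k (reflect (rotate d)) p)))
               , (λ (M≢L , x , x∈A , xM) →
                   line-fibre i≢k (reflect (rotate d)) (colour-from-point d′ M≢L (sym (colour-of x∈A)) xM))
    }
    where
    open Colouring colouring
    k = ℓ L
    U : ∀ M → ℓ M ≡ k → M ≡ L
    U M eq = unique M (Δ.opp-injective eq)
    open UniqueLine 𝒫 colouring U
    i = proj₁ (others k)
    j = proj₁ (proj₂ (others k))
    d : Distinct i j k
    d = proj₂ (proj₂ (others k))
    d′ : Distinct j i k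
    d′ = rotate (reflect d)
    i≢j = proj₁ d
    j≢k = proj₁ (proj₂ d)
    i≢k = proj₂ (proj₂ d)

    colour-of : ∀ {i x} → Δ.vertex i ≡ onPoints x → i ≡ κ x
    colour-of eq = trans (sym (Δ.colour-vertex _)) (cong Δ.colour eq)

    fibre : ∀ {i x} → κ x ≡ i → Δ.vertex i ≡ onPoints x
    fibre refl = Δ.vertex-colour _

    satisfiable : ∀ i → ∃[ x ] Δ.vertex i ≡ onPoints x
    satisfiable i = let x , κx = κ-onto i in x , fibre κx

    on⇐ : ∀ {i x} → i ≢ k → Δ.vertex i ≡ onPoints x → x 𝒫.I L
    on⇐ i≢k p = on-unique-line λ κx → i≢k (trans (colour-of p) κx)

    on⇒ : ∀ x → x 𝒫.I L → Δ.vertex i ≡ onPoints x ⊎ Δ.vertex j ≡ onPoints x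
    on⇒ x xL with κ x ≟ i
    ... | yes κx = inj₁ (fibre κx)
    ... | no  ne = inj₂ (fibre (remaining (rotate (rotate d)) (proper xL) ne))

    off : ∀ x → ¬ x 𝒫.I L → κ x ≡ k
    off x x∉L with κ x ≟ k
    ... | yes κx = κx
    ... | no  ne = contradiction (on-unique-line ne) x∉L

    line-colour : ∀ {i j k} (i≢j : i ≢ j) → Distinct i j k → ∀ {M} →
      Δ.join (Δ.vertex-≢ i≢j) ≡ onLines M → ℓ M ≡ k
    line-colour i≢j d eq = trans (cong Δ.opp (sym eq)) (Δ.opp-side i≢j d)

    line-fibre : ∀ {i j k} (i≢j : i ≢ j) → Distinct i j k → ∀ {M} →
      ℓ M ≡ k → Δ.join (Δ.vertex-≢ i≢j) ≡ onLines M
    line-fibre i≢j d eq = Δ.opp-injective (trans (Δ.opp-side i≢j d) (sym eq))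

    covered : ∀ {M j} → M ≢ L × (∃[ x ] κ x ≡ j × x 𝒫.I M) →
      M ≢ L × (∃[ x ] Δ.vertex j ≡ onPoints x × x 𝒫.I M)
    covered (M≢L , x , κx , xM) = M≢L , x , fibre κx , xM

-- A point alone in its fibre is a line alone in its fibre for the dual epimorphism.
typeA-or-typeB : (𝒫 : FiniteThickPlane) (Δ : OrdinaryTriangle) (Φ : 𝒫 ↠ Δ) →
  IsTypeA 𝒫 Δ Φ ⊎ IsTypeB 𝒫 Δ Φ
typeA-or-typeB 𝒫 Δ Φ =
  [ (λ (L , unique) → inj₁ (unique-line⇒typeA 𝒫 Δ Φ
      (L , λ M eq → unique M (cong Δ.opp eq))))
  , (λ (x , unique) → inj₂ (unique-line⇒typeA (dualPlane 𝒫) (dualOrdinaryTriangle Δ) (dualEpimorphism Φ)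
      (x , λ y eq → unique y (cong Δ.colour eq))))
  ]′ (unique-point-or-line 𝒫 (colouring 𝒫 Δ Φ))
  where module Δ = Triangle Δ

-- For a point p₀ of a line L, map p₀ to a, the other points of L to b, and
-- the points off L to c.
module Existence (𝒫 : FiniteThickPlane) (Δ : OrdinaryTriangle) where
  open Incidence 𝒫
  private module Δ = Triangle Δ

  private
    a b c : Δ.Point
    a = proj₁ Δ.triangle
    b = proj₁ (proj₂ Δ.triangle)
    c = proj₁ (proj₂ (proj₂ Δ.triangle))
    a≢b : a ≢ b
    a≢b = proj₁ (proj₂ (proj₂ (proj₂ Δ.triangle)))
    b≢c : b ≢ c
    b≢c = proj₁ (proj₂ (proj₂ (proj₂ (proj₂ Δ.triangle))))
    a≢c : a ≢ c
    a≢c = proj₁ (proj₂ (proj₂ (proj₂ (proj₂ (proj₂ Δ.triangle)))))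
    noncollinear : ∀ m → ¬ (a Δ.I m × b Δ.I m × c Δ.I m)
    noncollinear = proj₂ (proj₂ (proj₂ (proj₂ (proj₂ (proj₂ Δ.triangle)))))

    abc : Distinct (Δ.colour a) (Δ.colour b) (Δ.colour c)
    abc = a≢b ∘ Δ.colour-injective , b≢c ∘ Δ.colour-injective , a≢c ∘ Δ.colour-injective

    on-join : ∀ {x y} (x≢y : x ≢ y) → x Δ.I Δ.join x≢y × y Δ.I Δ.join x≢y
    on-join x≢y = proj₁ (proj₂ (Δ.uniqueJoin x≢y))

    p₀ q₀ : Point
    p₀ = proj₁ triangle
    q₀ = proj₁ (proj₂ triangle)
    p₀≢q₀ : p₀ ≢ q₀
    p₀≢q₀ = proj₁ (proj₂ (proj₂ (proj₂ triangle)))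
    r₀ : Point
    r₀ = proj₁ (proj₂ (proj₂ triangle))
    L : Line
    L = join p₀≢q₀
    p₀∈L : p₀ I L
    p₀∈L = proj₁ (proj₁ (proj₂ (uniqueJoin p₀≢q₀)))
    q₀∈L : q₀ I L
    q₀∈L = proj₂ (proj₁ (proj₂ (uniqueJoin p₀≢q₀)))
    r₀∉L : ¬ r₀ I L
    r₀∉L r₀∈L = proj₂ (proj₂ (proj₂ (proj₂ (proj₂ (proj₂ triangle))))) L (p₀∈L , q₀∈L , r₀∈L)

    pointImage : ∀ {x} → Dec (x ≡ p₀) → Dec (x I L) → Δ.Point
    pointImage (yes _) _       = a
    pointImage (no _)  (yes _) = b
    pointImage (no _)  (no _)  = c

    -- A line other than `L` goes to the side joining `c` to the image of its intersection with `L`.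
    lineImage : ∀ {M} → Dec (M ≡ L) → Dec (p₀ I M) → Δ.Line
    lineImage (yes _) _       = Δ.join a≢b
    lineImage (no _)  (yes _) = Δ.join a≢c
    lineImage (no _)  (no _)  = Δ.join b≢c

    -- The three combinations with non-incident images contradict `x I M`; one of them because a
    -- point of `L` other than `p₀` is joined to `p₀` by `L` only.
    preserves : ∀ {x M} (d : Dec (x ≡ p₀)) (e : Dec (x I L)) (f : Dec (M ≡ L)) (g : Dec (p₀ I M)) →
      x I M → pointImage d e Δ.I lineImage f g
    preserves (yes _)    _        (yes _)    _        _  = proj₁ (on-join a≢b)
    preserves (yes _)    _        (no _)     (yes _)  _  = proj₁ (on-join a≢c)
    preserves (yes refl) _        (no _)     (no p∉M) xM = contradiction xM p∉M
    preserves (no _)     (yes _)  (yes _)    _        _  = proj₂ (on-join a≢b)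
    preserves (no x≢p)   (yes xL) (no M≢L)   (yes pM) xM =
      contradiction (join-unique x≢p xM pM xL p₀∈L) M≢L
    preserves (no _)     (yes _)  (no _)     (no _)   _  = proj₁ (on-join b≢c)
    preserves (no _)     (no x∉L) (yes refl) _        xM = contradiction xM x∉L
    preserves (no _)     (no _)   (no _)     (yes _)  _  = proj₂ (on-join a≢c)
    preserves (no _)     (no _)   (no _)     (no _)   _  = proj₂ (on-join b≢c)

    onPoints : Point → Δ.Point
    onPoints x = pointImage (x ≟ᴾ p₀) (x I? L)

    onLines : Line → Δ.Line
    onLines M = lineImage (M ≟ᴸ L) (p₀ I? M)

    points-a : onPoints p₀ ≡ a
    points-a with p₀ ≟ᴾ p₀
    ... | yes _ = refl
    ... | no  n = contradiction refl n

    points-b : onPoints q₀ ≡ b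
    points-b with q₀ ≟ᴾ p₀ | q₀ I? L
    ... | yes eq | _      = contradiction (sym eq) p₀≢q₀
    ... | no _   | yes _  = refl
    ... | no _   | no q∉L = contradiction q₀∈L q∉L

    points-c : onPoints r₀ ≡ c
    points-c with r₀ ≟ᴾ p₀ | r₀ I? L
    ... | yes eq | _      = contradiction (subst (_I L) (sym eq) p₀∈L) r₀∉L
    ... | no _   | yes rL = contradiction rL r₀∉L
    ... | no _   | no _   = refl

    lines-ab : onLines L ≡ Δ.join a≢b
    lines-ab with L ≟ᴸ L
    ... | yes _ = refl
    ... | no  n = contradiction refl n

    lines-ac : ∀ {M} → M ≢ L → p₀ I M → onLines M ≡ Δ.join a≢c
    lines-ac {M} M≢L pM with M ≟ᴸ L | p₀ I? M
    ... | yes eq | _      = contradiction eq M≢L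
    ... | no _   | yes _  = refl
    ... | no _   | no p∉M = contradiction pM p∉M

    lines-bc : ∀ {M} → M ≢ L → ¬ p₀ I M → onLines M ≡ Δ.join b≢c
    lines-bc {M} M≢L p∉M with M ≟ᴸ L | p₀ I? M
    ... | yes eq | _      = contradiction eq M≢L
    ... | no _   | yes pM = contradiction pM p∉M
    ... | no _   | no _   = refl

    surjective-points : ∀ y → ∃[ x ] onPoints x ≡ y
    surjective-points y with Δ.colour y ≟ Δ.colour a | Δ.colour y ≟ Δ.colour b
    ... | yes eq | _      = p₀ , trans points-a (sym (Δ.colour-injective eq))
    ... | no _   | yes eq = q₀ , trans points-b (sym (Δ.colour-injective eq))
    ... | no ≢a  | no ≢b  = r₀ , trans points-c (sym (Δ.colour-injective (remaining abc ≢a ≢b)))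

    -- A line of the triangle is determined by the vertex it misses, so the three joins are all of
    -- them.
    sides : ∀ m → Dec (Δ.opp m ≡ Δ.colour c) → Dec (Δ.opp m ≡ Δ.colour b) →
      Δ.join a≢b ≡ m ⊎ Δ.join a≢c ≡ m ⊎ Δ.join b≢c ≡ m
    sides m (yes eq) _        = inj₁ (Δ.opp-injective (trans (Δ.opp-join a≢b abc) (sym eq)))
    sides m (no _)   (yes eq) = inj₂ (inj₁ (Δ.opp-injective
      (trans (Δ.opp-join a≢c (reflect (rotate abc))) (sym eq))))
    sides m (no ≢c)  (no ≢b)  = inj₂ (inj₂ (Δ.opp-injective
      (trans (Δ.opp-join b≢c (rotate abc)) (sym (remaining (reflect abc) ≢c ≢b)))))

    surjective-ac : ∃[ M ] onLines M ≡ Δ.join a≢c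
    surjective-ac = let M , M≢L , pM = another-line p₀ L in M , lines-ac M≢L pM

    surjective-bc : ∃[ M ] onLines M ≡ Δ.join b≢c
    surjective-bc = let M , M≢L , qM = another-line q₀ L in
      M , lines-bc M≢L λ pM → M≢L (join-unique p₀≢q₀ pM qM p₀∈L q₀∈L)

    surjective-lines : ∀ m → ∃[ M ] onLines M ≡ m
    surjective-lines m =
      [ (λ eq → L , trans lines-ab eq)
      , [ (λ eq → let M , ac = surjective-ac in M , trans ac eq)
        , (λ eq → let M , bc = surjective-bc in M , trans bc eq) ]′
      ]′ (sides m (Δ.opp m ≟ Δ.colour c) (Δ.opp m ≟ Δ.colour b))

    -- The other two sides contain `c`, so neither can equal the side `ab`.
    unique-ab : ∀ {M} (f : Dec (M ≡ L)) (g : Dec (p₀ I M)) → lineImage f g ≡ Δ.join a≢b → M ≡ L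
    unique-ab (yes M≡L) _       _  = M≡L
    unique-ab (no _)    (yes _) eq = contradiction
      (proj₁ (on-join a≢b) , proj₂ (on-join a≢b) , subst (c Δ.I_) eq (proj₂ (on-join a≢c)))
      (noncollinear _)
    unique-ab (no _)    (no _)  eq = contradiction
      (proj₁ (on-join a≢b) , proj₂ (on-join a≢b) , subst (c Δ.I_) eq (proj₂ (on-join b≢c)))
      (noncollinear _)

    unique : ∀ M → onLines M ≡ onLines L → M ≡ L
    unique M eq = unique-ab (M ≟ᴸ L) (p₀ I? M) (trans eq lines-ab)

    Φ : 𝒫 ↠ Δ
    Φ = record
      { onPoints           = onPoints
      ; onLines            = onLines
      ; preservesIncidence = λ {x} {M} → preserves (x ≟ᴾ p₀) (x I? L) (M ≟ᴸ L) (p₀ I? M)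
      ; surjectiveOnPoints = surjective-points
      ; surjectiveOnLines  = surjective-lines
      }

  exists-typeA : ∃[ Φ ] IsTypeA 𝒫 Δ Φ
  exists-typeA = Φ , unique-line⇒typeA 𝒫 Δ Φ (L , unique)

-- Dualising an epimorphism twice gives it back by record eta, so the type (a) evidence for the dual
-- plane is reused unchanged.
exists-typeB : (𝒫 : FiniteThickPlane) (Δ : OrdinaryTriangle) → ∃[ Φ ] IsTypeB 𝒫 Δ Φ
exists-typeB 𝒫 Δ = let Φ , typeA = Existence.exists-typeA (dualPlane 𝒫) (dualOrdinaryTriangle Δ) in
  dualEpimorphism Φ , typeA

-- The Fano plane from the perfect difference set {0, 1, 3} modulo 7.
fano : FiniteThickPlane
fano = record
  { geometry          = record { Point = Fin 7 ; Line = Fin 7 ; _I_ = _∈ᶠ_ }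
  ; isProjectivePlane = record
    { uniqueJoin = λ {x} {y} → joins x y
    ; uniqueMeet = λ {L} {M} L≢M → let x , (Lx , Mx) , unique = joins L M L≢M in
        x , (flipᶠ L x Lx , flipᶠ M x Mx) , λ {y} (yL , yM) → unique (flipᶠ y L yL , flipᶠ y M yM)
    ; triangle   = 0F , 1F , 2F , (λ ()) , (λ ()) , (λ ()) , from-yes (all? λ L →
        ¬? ((0F ∈ᶠ? L) ×-dec (1F ∈ᶠ? L) ×-dec (2F ∈ᶠ? L)))
    }
  ; finitePoints      = 7 , ↔-id _
  ; finiteLines       = 7 , ↔-id _
  ; thickLines        = three
  ; thickPoints       = λ x → let p , q , r , p≢q , q≢r , p≢r , xp , xq , xr = three x in
      p , q , r , p≢q , q≢r , p≢r , flipᶠ p x xp , flipᶠ q x xq , flipᶠ r x xr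
  }
  where
  _∈ᶠ_ : Fin 7 → Fin 7 → Set
  x ∈ᶠ L = (toℕ x + toℕ L) % 7 ∈ᴸ 0 ∷ 1 ∷ 3 ∷ []

  _∈ᶠ?_ : ∀ x L → Dec (x ∈ᶠ L)
  x ∈ᶠ? L = _∈?_ _≟ℕ_ ((toℕ x + toℕ L) % 7) (0 ∷ 1 ∷ 3 ∷ [])

  -- Incidence depends on the sum of the indices only, so the results on meets and on points follow
  -- from those on joins and on lines.
  flipᶠ : ∀ x L → x ∈ᶠ L → L ∈ᶠ x
  flipᶠ x L = subst (λ n → n % 7 ∈ᴸ 0 ∷ 1 ∷ 3 ∷ []) (+-comm (toℕ x) (toℕ L))

  joins : ∀ x y → x ≢ y → ∃! _≡_ λ L → x ∈ᶠ L × y ∈ᶠ L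
  joins x y x≢y = let L , xyL , unique = table x y x≢y in L , xyL , λ {M} → unique M
    where
    table : ∀ x y → x ≢ y → ∃[ L ] (x ∈ᶠ L × y ∈ᶠ L) × (∀ M → x ∈ᶠ M × y ∈ᶠ M → L ≡ M)
    table = from-yes (all? λ x → all? λ y → ¬? (x ≟ y) →-dec any? λ L →
      ((x ∈ᶠ? L) ×-dec (y ∈ᶠ? L)) ×-dec all? λ M → ((x ∈ᶠ? M) ×-dec (y ∈ᶠ? M)) →-dec (L ≟ M))

  three : ∀ L → AtLeastThree (_∈ᶠ L)
  three = from-yes (all? λ L → any? λ x → any? λ y → any? λ z →
    ¬? (x ≟ y) ×-dec ¬? (y ≟ z) ×-dec ¬? (x ≟ z) ×-dec (x ∈ᶠ? L) ×-dec (y ∈ᶠ? L) ×-dec (z ∈ᶠ? L))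

-- A line of the triangle is named by the vertex it misses.
ordinaryTriangle : OrdinaryTriangle
ordinaryTriangle = record
  { geometry          = record { Point = Colour ; Line = Colour ; _I_ = _≢_ }
  ; isProjectivePlane = record
    { uniqueJoin = λ x≢y → let k , d@(_ , y≢k , x≢k) = third x≢y in
        k , (x≢k , y≢k) , λ (x≢m , y≢m) → sym (remaining d (≢-sym x≢m) (≢-sym y≢m))
    ; uniqueMeet = λ L≢M → let k , d@(_ , M≢k , L≢k) = third L≢M in
        k , (≢-sym L≢k , ≢-sym M≢k) , λ (m≢L , m≢M) → sym (remaining d m≢L m≢M)
    ; triangle   = 0F , 1F , 2F , (λ ()) , (λ ()) , (λ ()) , λ L (0≢L , 1≢L , 2≢L) →
        2≢L (sym (remaining {0F} {1F} ((λ ()) , (λ ()) , (λ ())) (≢-sym 0≢L) (≢-sym 1≢L)))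
    }
  ; threePoints       = ↔-id _
  ; threeLines        = ↔-id _
  ; thinLines         = two
  ; thinPoints        = λ x → let y , z , y≢z , to , from = two x in
      y , z , y≢z , (λ x≢w → to (≢-sym x≢w)) , (λ w → ≢-sym (from w))
  }
  where
  two : ∀ k → ExactlyTwo (_≢ k)
  two k with others k
  ... | i , j , d@(i≢j , j≢k , i≢k) = i , j , i≢j , split , λ { (inj₁ refl) → i≢k ; (inj₂ refl) → j≢k }
    where
    split : ∀ {x} → x ≢ k → i ≡ x ⊎ j ≡ x
    split {x} x≢k with i ≟ x
    ... | yes i≡x = inj₁ i≡x
    ... | no  i≢x = inj₂ (sym (remaining (rotate (rotate d)) x≢k (≢-sym i≢x)))

theorem3p1 : (∀ (𝒫 : FiniteThickPlane) (Δ : OrdinaryTriangle) →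
    (∀ (Φ : 𝒫 ↠ Δ) → IsTypeA 𝒫 Δ Φ ⊎ IsTypeB 𝒫 Δ Φ)
    × (∃[ Φ ] IsTypeA 𝒫 Δ Φ)
    × (∃[ Φ ] IsTypeB 𝒫 Δ Φ))
    × FiniteThickPlane
    × OrdinaryTriangle
theorem3p1 =
  (λ 𝒫 Δ → typeA-or-typeB 𝒫 Δ , Existence.exists-typeA 𝒫 Δ , exists-typeB 𝒫 Δ) ,
  -- Concrete instances show that the quantification over planes and triangles is not vacuous.
  fano , ordinaryTriangle
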